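{- Let $(G;+)$ be a commutative groupoid and let $M, M'$ be multisets of cardinality $3$ over $G$. Then the deck of $M$ equals the deck of $M'$ if and only if one of the following holds: (i) $M = M'$; (ii) $M = \langle r,s,t\rangle$ and $M' = \langle r, r+s, r+t\rangle$ for some $r,s,t \in G$ with $r + (r+s) = s$, $r + (r+t) = t$ and $(r+s)+(r+t) = s+t$; (iii) $M = \langle r,s,t\rangle$ and $M' = \langle r+s, r+t, s+t\rangle$ for some $r,s,t \in G$ with $(r+s)+(r+t) = r$, $(r+s)+(s+t) = s$ and $(r+t)+(s+t) = t$.
   Context: A (finite) multiset $M$ over a set $X$ is a function $\mathbf{1}_M \colon X \to \mathbb{N}$ with finite support; $|M| = \sum_x \mathbf{1}_M(x)$ is its cardinality. $\langle x_1,\dots,x_k\rangle$ denotes the multiset in which each element occurs as often as it appears in the list. A commutative groupoid is a set $G$ with a commutative binary operation $+$ (not necessarily associative). For a 3-multiset $M=\langle a,b,c\rangle$ over $G$ its cards are $\langle a, b+c\rangle$, $\langle b, a+c\rangle$, $\langle c, a+b\rangle$, and its deck is the multiset of these three cards. (In general, for $M = \langle m_1,\dots,m_n\rangle$, the card $M_{\{i,j\}}$ replaces $m_i, m_j$ by the single element $m_i+m_j$, and the deck is the multiset of all $\binom n2$ cards.) -}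

module Defs where

open import Algebra.Bundles using (CommutativeMagma)
open import Data.List.Base using (List; []; _∷_; _++_; map)
open import Data.Product.Base using (_×_; _,_; map₂; uncurry)
open import Level using (Level; _⊔_)
open import Relation.Binary.Bundles using (Setoid)
import Data.List.Relation.Binary.Permutation.Setoid as Permutation

private
  variable
    a c ℓ : Level

-- Finite multisets over S: finite lists of elements, equal when they are
-- permutations of each other up to the equality of S.  The list
-- x₁ ∷ … ∷ xₖ ∷ [] stands for ⟨x₁,…,xₖ⟩ and its length is the cardinality.
Multiset : Setoid a ℓ → Setoid a (a ⊔ ℓ)
Multiset S = Permutation.↭-setoid S

-- Every way of singling out one occurrence, paired with the remaining list.
select : {A : Set a} → List A → List (A × List A)
select []       = []
select (x ∷ xs) = (x , xs) ∷ map (map₂ (x ∷_)) (select xs)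

module Deck (G : CommutativeMagma c ℓ) where

  open CommutativeMagma G public
    using (Carrier; _≈_; setoid) renaming (_∙_ to infixl 6 _+_)

  infix 4 _≈ₘ_ _≈ₘₘ_

  _≈ₘ_ : List Carrier → List Carrier → Set (c ⊔ ℓ)
  _≈ₘ_ = Setoid._≈_ (Multiset setoid)

  -- Multisets of multisets: the cards, too, are compared as multisets.
  _≈ₘₘ_ : List (List Carrier) → List (List Carrier) → Set (c ⊔ ℓ)
  _≈ₘₘ_ = Setoid._≈_ (Multiset (Multiset setoid))

  -- One card M_{i,j} for each pair of positions i < j: the first map merges
  -- the head with a later element, the second keeps the head and merges two
  -- elements of the tail.
  deck : List Carrier → List (List Carrier)
  deck []       = []
  deck (x ∷ xs) = map (uncurry λ y ys → (x + y) ∷ ys) (select xs)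
               ++ map (x ∷_) (deck xs)

{-# OPTIONS --safe #-}

-- A card of a 3-multiset is a pair {c, a+b}, so equality of two decks aligns
-- the elements a,b,c of M with the elements x,y,z of M′ in such a way that each
-- pair {c, a+b} agrees with the corresponding {z, x+y} either straight or
-- crossed.  A single crossed pair is also straight: a = x and b = y give
-- c = x+y = a+b = z, so M = M′.  Two crossed pairs are exactly (ii) and three
-- are exactly (iii).

module Submission where

open import Defs
open import Algebra.Bundles using (CommutativeMagma)
open import Data.List.Base using (List; []; _∷_; _++_; length; map)
open import Data.List.Properties using (map-∘; map-++)
import Data.List.Relation.Binary.Permutation.Setoid as Permutation
import Data.List.Relation.Binary.Permutation.Setoid.Properties as Permutationₚ
import Data.List.Relation.Binary.Pointwise as Pointwise
open import Data.List.Relation.Unary.Any using (Any; here; there)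
open import Data.Product using (_×_; _,_; ∃-syntax)
open import Data.Product.Relation.Binary.Pointwise.NonDependent using (_×ₛ_)
open import Data.Sum.Base using (_⊎_; inj₁; inj₂)
open import Function.Bundles using (_⇔_; mk⇔)
open import Level using (_⊔_)
open import Relation.Binary.Bundles using (Setoid)
open import Relation.Binary.PropositionalEquality as ≡ using (_≡_)

-- Permutations up to setoid equality and their inversion.

module _ {a ℓ b ℓ′} (S : Setoid a ℓ) (T : Setoid b ℓ′) where

  private
    module S = Setoid S
    module T = Setoid T
    module ↭S = Permutation S
    module ↭T = Permutation T

  map-cong-↭ : {f g : S.Carrier → T.Carrier} →
               (∀ {x y} → x S.≈ y → f x T.≈ g y) →
               ∀ {xs ys} → xs ↭S.↭ ys → map f xs ↭T.↭ map g ys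
  map-cong-↭ {f} {g} f≈g xs↭ys = ↭T.trans
    (↭T.refl (Pointwise.map⁺ f g (Pointwise.map f≈g (Pointwise.refl S.refl))))
    -- Congruence of `g` comes from using `f≈g` twice: `g x ≈ f x ≈ g y`.
    (Permutationₚ.map⁺ S T (λ x≈y → T.trans (T.sym (f≈g S.refl)) (f≈g x≈y)) xs↭ys)

module Selection {a ℓ} (S : Setoid a ℓ) where

  open Setoid S using (_≈_)
  private module ≈ = Setoid S
  open Permutation S hiding (module ≈)

  Selections : Setoid a (a ⊔ ℓ)
  Selections = S ×ₛ Multiset S

  private
    module Sel = Setoid Selections
    module ↭Sel = Permutation Selections

  select-prep : ∀ {x y xs ys} → x ≈ y → xs ↭ ys →
                select xs ↭Sel.↭ select ys → select (x ∷ xs) ↭Sel.↭ select (y ∷ ys)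
  select-prep x≈y xs↭ys ih = ↭Sel.prep (x≈y , xs↭ys)
    (map-cong-↭ Selections Selections (λ (z≈w , zs↭ws) → z≈w , prep x≈y zs↭ws) ih)

  select-swap : ∀ x y xs → select (x ∷ y ∷ xs) ↭Sel.↭ select (y ∷ x ∷ xs)
  select-swap x y xs = ↭Sel.swap Sel.refl Sel.refl
    -- Fusing the nested maps leaves both tails as one map over `select xs`, differing only in the
    -- order of `x` and `y` in each remainder.
    (≡.subst₂ ↭Sel._↭_ (map-∘ (select xs)) (map-∘ (select xs))
      (map-cong-↭ Selections Selections
        (λ (z≈w , zs↭ws) → z≈w , swap ≈.refl ≈.refl zs↭ws) (↭Sel.↭-refl {select xs})))

  select⁺ : ∀ {xs ys} → xs ↭ ys → select xs ↭Sel.↭ select ys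
  select⁺ (refl Pointwise.[]) = ↭Sel.↭-refl
  select⁺ (refl (x≈y Pointwise.∷ xs≋ys)) = select-prep x≈y (refl xs≋ys) (select⁺ (refl xs≋ys))
  select⁺ (prep x≈y xs↭ys) = select-prep x≈y xs↭ys (select⁺ xs↭ys)
  select⁺ (swap {x = x} {y = y} x≈x′ y≈y′ xs↭ys) = ↭Sel.trans (select-swap x y _)
    (select-prep y≈y′ (prep x≈x′ xs↭ys) (select-prep x≈x′ xs↭ys (select⁺ xs↭ys)))
  select⁺ (trans xs↭ys ys↭zs) = ↭Sel.trans (select⁺ xs↭ys) (select⁺ ys↭zs)

  -- An inversion principle for `↭`, whose `trans` constructor hides where `x` goes. The head of
  -- `select (x ∷ xs)` is `(x , xs)`, and `select⁺` carries it to a matching entry of `select ys`.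
  ∷-↭⇒select : ∀ {x xs ys} → x ∷ xs ↭ ys →
               Any (λ (y , ys′) → x ≈ y × xs ↭ ys′) (select ys)
  ∷-↭⇒select p = Permutationₚ.Any-resp-↭ Selections
    (λ e f → Sel.trans f e) (select⁺ p) (here Sel.refl)

  [-]-injective : ∀ {x y} → x ∷ [] ↭ y ∷ [] → x ≈ y
  [-]-injective p with here (x≈y , _) ← ∷-↭⇒select p = x≈y

  -- On two cards written sum first, the two outcomes are by definition `Straight` and `Crossed`.
  pair-↭⁻ : ∀ {x y u v} → x ∷ y ∷ [] ↭ u ∷ v ∷ [] →
            (x ≈ u × y ≈ v) ⊎ (x ≈ v × y ≈ u)
  pair-↭⁻ p with ∷-↭⇒select p
  ... | here (x≈u , q)         = inj₁ (x≈u , [-]-injective q)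
  ... | there (here (x≈v , q)) = inj₂ (x≈v , [-]-injective q)

  pair-swap : ∀ {x y u v} → x ≈ v → y ≈ u → x ∷ y ∷ [] ↭ u ∷ v ∷ []
  pair-swap x≈v y≈u = swap x≈v y≈u ↭-refl

module ThreeDecks {g ℓ} (G : CommutativeMagma g ℓ) where

  open Deck G
  open CommutativeMagma G using (comm)
  private module ≈ = CommutativeMagma G
  open ≈ using () renaming (∙-cong to +-cong)
  open Permutation setoid hiding (module ≈)
  open Selection setoid
  private
    Cards = Multiset setoid
    module ↭C = Permutation Cards
    module Deckₛ = Selection Cards
    module C = Permutationₚ Cards

  -- Invariance of the deck under permutation.

  deck-prep : ∀ {x y xs ys} → x ≈ y → xs ↭ ys →
              deck xs ≈ₘₘ deck ys → deck (x ∷ xs) ≈ₘₘ deck (y ∷ ys)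
  deck-prep x≈y xs↭ys ih = C.++⁺
    (map-cong-↭ Selections Cards (λ (z≈w , zs↭ws) → prep (+-cong x≈y z≈w) zs↭ws) (select⁺ xs↭ys))
    (map-cong-↭ Cards Cards (prep x≈y) ih)

  -- Sorts the cards by what happens to the first two elements: merged together, only `x` merged,
  -- only `y` merged, both kept. Swapping `x` and `y` exchanges the two middle blocks.
  deck-∷-∷ : ∀ x y xs → deck (x ∷ y ∷ xs) ≡
    (x + y ∷ xs) ∷ map (λ (z , zs) → x + z ∷ y ∷ zs) (select xs)
                ++ map (λ (z , zs) → x ∷ y + z ∷ zs) (select xs)
                ++ map (λ zs → x ∷ y ∷ zs) (deck xs)
  deck-∷-∷ x y xs = ≡.cong ((x + y ∷ xs) ∷_) (≡.cong₂ _++_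
    (≡.sym (map-∘ (select xs)))
    (≡.trans (map-++ (x ∷_) (map (λ (z , zs) → y + z ∷ zs) (select xs)) _)
             (≡.cong₂ _++_ (≡.sym (map-∘ (select xs))) (≡.sym (map-∘ (deck xs))))))

  deck-swap : ∀ x y xs → deck (x ∷ y ∷ xs) ≈ₘₘ deck (y ∷ x ∷ xs)
  deck-swap x y xs = ≡.subst₂ _≈ₘₘ_ (≡.sym (deck-∷-∷ x y xs)) (≡.sym (deck-∷-∷ y x xs))
    (↭C.prep (prep (comm x y) ↭-refl) (↭C.trans
      (C.shifts (map (λ (z , zs) → x + z ∷ y ∷ zs) (select xs))
                (map (λ (z , zs) → x ∷ y + z ∷ zs) (select xs)))
      (C.++⁺ (map-cong-↭ Selections Cards
               (λ (z≈w , zs↭ws) → swap ≈.refl (+-cong ≈.refl z≈w) zs↭ws) sel-refl)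
      (C.++⁺ (map-cong-↭ Selections Cards
               (λ (z≈w , zs↭ws) → swap (+-cong ≈.refl z≈w) ≈.refl zs↭ws) sel-refl)
             (map-cong-↭ Cards Cards (swap ≈.refl ≈.refl) (↭C.↭-refl {deck xs}))))))
    where sel-refl = Permutation.↭-refl Selections {select xs}

  deck⁺ : ∀ {xs ys} → xs ≈ₘ ys → deck xs ≈ₘₘ deck ys
  deck⁺ (refl Pointwise.[]) = ↭C.↭-refl
  deck⁺ (refl (x≈y Pointwise.∷ xs≋ys)) = deck-prep x≈y (refl xs≋ys) (deck⁺ (refl xs≋ys))
  deck⁺ (prep x≈y xs↭ys) = deck-prep x≈y xs↭ys (deck⁺ xs↭ys)
  deck⁺ (swap {x = x} {y = y} x≈x′ y≈y′ xs↭ys) = ↭C.trans (deck-swap x y _)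
    (deck-prep y≈y′ (prep x≈x′ xs↭ys) (deck-prep x≈x′ xs↭ys (deck⁺ xs↭ys)))
  deck⁺ (trans xs↭ys ys↭zs) = ↭C.trans (deck⁺ xs↭ys) (deck⁺ ys↭zs)

  -- The alternatives (i) to (iii), and equality of decks from each.

  FixesOne : (M M′ : List Carrier) → Set _
  FixesOne M M′ = ∃[ r ] ∃[ s ] ∃[ t ]
    ( (M ≈ₘ r ∷ s ∷ t ∷ [])
    × (M′ ≈ₘ r ∷ (r + s) ∷ (r + t) ∷ [])
    × ((r + (r + s)) ≈ s)
    × ((r + (r + t)) ≈ t)
    × (((r + s) + (r + t)) ≈ (s + t)) )

  FixesNone : (M M′ : List Carrier) → Set _
  FixesNone M M′ = ∃[ r ] ∃[ s ] ∃[ t ]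
    ( (M ≈ₘ r ∷ s ∷ t ∷ [])
    × (M′ ≈ₘ (r + s) ∷ (r + t) ∷ (s + t) ∷ [])
    × (((r + s) + (r + t)) ≈ r)
    × (((r + s) + (s + t)) ≈ s)
    × (((r + t) + (s + t)) ≈ t) )

  Related : (M M′ : List Carrier) → Set _
  Related M M′ = (M ≈ₘ M′) ⊎ FixesOne M M′ ⊎ FixesNone M M′

  Related-resp : ∀ {M M′ N N′} → M ≈ₘ N → M′ ≈ₘ N′ → Related N N′ → Related M M′
  Related-resp p p′ (inj₁ q) = inj₁ (trans p (trans q (↭-sym p′)))
  Related-resp p p′ (inj₂ (inj₁ (r , s , t , q , q′ , eqs))) =
    inj₂ (inj₁ (r , s , t , trans p q , trans p′ q′ , eqs))
  Related-resp p p′ (inj₂ (inj₂ (r , s , t , q , q′ , eqs))) =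
    inj₂ (inj₂ (r , s , t , trans p q , trans p′ q′ , eqs))

  Related⇒deck : ∀ {M M′} → Related M M′ → deck M ≈ₘₘ deck M′
  Related⇒deck (inj₁ p) = deck⁺ p
  Related⇒deck (inj₂ (inj₁ (r , s , t , p , p′ , es , et , est))) =
    ↭C.trans (deck⁺ p) (↭C.trans
      -- The card `⟨r+s, t⟩` is the second card of `M′`, since `t ≈ r + (r + t)`; likewise
      -- `⟨r+t, s⟩` is the first. The third cards agree.
      (↭C.swap (pair-swap ≈.refl (≈.sym et)) (pair-swap ≈.refl (≈.sym es))
        (↭C.prep (prep ≈.refl (prep (≈.sym est) ↭-refl)) ↭C.↭-refl))
      (deck⁺ (↭-sym p′)))
  Related⇒deck (inj₂ (inj₂ (r , s , t , p , p′ , er , es , et))) =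
    ↭C.trans (deck⁺ p) (↭C.trans
      -- The card `⟨r, s+t⟩` moves to the front, where it meets the card of `M′` that merges `r + s`
      -- and `r + t`; the other two then trade places.
      (↭C.trans (C.++-comm (_ ∷ _ ∷ []) (_ ∷ []))
        (↭C.prep (prep (≈.sym er) ↭-refl)
          (↭C.swap (prep ≈.refl (prep (≈.sym et) ↭-refl)) (pair-swap ≈.refl (≈.sym es)) ↭C.↭-refl)))
      (deck⁺ (↭-sym p′)))

  -- Analysis of aligned cards.

  Straight Crossed Matched : (a b c x y z : Carrier) → Set ℓ
  Straight a b c x y z = a + b ≈ x + y × c ≈ z
  Crossed  a b c x y z = a + b ≈ z × c ≈ x + y
  Matched  a b c x y z = Straight a b c x y z ⊎ Crossed a b c x y z

  private
    variable
      a b c x y z : Carrier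

  flip-Crossed : Crossed a b c x y z → Crossed b a c y x z
  flip-Crossed (p , q) = ≈.trans (comm _ _) p , ≈.trans q (comm _ _)

  uncross : a ≈ x → b ≈ y → Crossed a b c x y z → c ≈ z
  uncross a≈x b≈y (p , q) = ≈.trans q (≈.trans (+-cong (≈.sym a≈x) (≈.sym b≈y)) p)

  rotate : a ∷ b ∷ c ∷ [] ≈ₘ c ∷ a ∷ b ∷ []
  rotate = Permutationₚ.++-comm setoid (_ ∷ _ ∷ []) (_ ∷ [])

  equal : a ≈ x → b ≈ y → c ≈ z → Related (a ∷ b ∷ c ∷ []) (x ∷ y ∷ z ∷ [])
  equal p q r = inj₁ (prep p (prep q (prep r ↭-refl)))

  -- Here `x ≈ a`, `y ≈ a + c` and `z ≈ a + b`, so `a`, `b`, `c` serve as `r`, `s`, `t` and the last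
  -- two entries of `M′` trade places. Substituting these into the remaining equations yields the
  -- conditions of (ii).
  crossed₂ : Straight b c a y z x → Crossed a c b x z y → Crossed a b c x y z →
             Related (a ∷ b ∷ c ∷ []) (x ∷ y ∷ z ∷ [])
  crossed₂ (b+c , a≈x) (a+c , b≈) (a+b , c≈) = inj₂ (inj₁ (_ , _ , _ , ↭-refl
    , prep (≈.sym a≈x) (pair-swap (≈.sym a+c) (≈.sym a+b))
    , ≈.trans (+-cong a≈x a+b) (≈.sym b≈)
    , ≈.trans (+-cong a≈x a+c) (≈.sym c≈)
    , ≈.trans (+-cong a+b a+c) (≈.trans (comm _ _) (≈.sym b+c))))

  -- Each of `x`, `y`, `z` is the sum of the two elements of `M` not aligned with it, so the list in
  -- (iii) is `M′` reversed.
  crossed₃ : Crossed b c a y z x → Crossed a c b x z y → Crossed a b c x y z →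
             Related (a ∷ b ∷ c ∷ []) (x ∷ y ∷ z ∷ [])
  crossed₃ (b+c , a≈) (a+c , b≈) (a+b , c≈) = inj₂ (inj₂ (_ , _ , _ , ↭-refl
    , trans (Permutationₚ.↭-reverse setoid (_ ∷ _ ∷ _ ∷ []))
            (prep (≈.sym a+b) (prep (≈.sym a+c) (prep (≈.sym b+c) ↭-refl)))
    , ≈.trans (+-cong a+b a+c) (≈.trans (comm _ _) (≈.sym a≈))
    , ≈.trans (+-cong a+b b+c) (≈.trans (comm _ _) (≈.sym b≈))
    , ≈.trans (+-cong a+c b+c) (≈.trans (comm _ _) (≈.sym c≈))))

  matched⇒Related : Matched a b c x y z → Matched a c b x z y → Matched b c a y z x →
                    Related (a ∷ b ∷ c ∷ []) (x ∷ y ∷ z ∷ [])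
  matched⇒Related (inj₁ (_ , r)) (inj₁ (_ , q)) (inj₁ (_ , p)) = equal p q r
  matched⇒Related (inj₂ R)       (inj₁ (_ , q)) (inj₁ (_ , p)) = equal p q (uncross p q R)
  matched⇒Related (inj₁ (_ , r)) (inj₂ Q)       (inj₁ (_ , p)) = equal p (uncross p r Q) r
  matched⇒Related (inj₁ (_ , r)) (inj₁ (_ , q)) (inj₂ P)       = equal (uncross q r P) q r
  matched⇒Related (inj₂ R)       (inj₂ Q)       (inj₁ P)       = crossed₂ P Q R
  -- `crossed₂` expects the element of the straight card in front: here that is `b`, in the next
  -- clause `c`.
  matched⇒Related (inj₂ R)       (inj₁ Q)       (inj₂ P)       =
    Related-resp (↭-swap _ _ ↭-refl) (↭-swap _ _ ↭-refl) (crossed₂ Q P (flip-Crossed R))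
  matched⇒Related (inj₁ R)       (inj₂ Q)       (inj₂ P)       =
    Related-resp rotate rotate (crossed₂ R (flip-Crossed P) (flip-Crossed Q))
  matched⇒Related (inj₂ R)       (inj₂ Q)       (inj₂ P)       = crossed₃ P Q R

  -- From equal decks to one of the alternatives.

  Matched-comm : Matched a b c x y z → Matched a b c y x z
  Matched-comm (inj₁ (p , q)) = inj₁ (≈.trans p (comm _ _) , q)
  Matched-comm (inj₂ (p , q)) = inj₂ (p , ≈.trans q (comm _ _))

  -- Puts the sum first in the third card too, so that all three cards have the shape `Matched`
  -- expects.
  deck-triple : ∀ a b c → deck (a ∷ b ∷ c ∷ []) ≈ₘₘ
                (a + b ∷ c ∷ []) ∷ (a + c ∷ b ∷ []) ∷ (b + c ∷ a ∷ []) ∷ []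
  deck-triple a b c = ↭C.↭-prep _ (↭C.↭-prep _ (↭C.prep (↭-swap _ _ ↭-refl) ↭C.↭-refl))

  deck⇒Related : ∀ a b c x y z → deck (a ∷ b ∷ c ∷ []) ≈ₘₘ deck (x ∷ y ∷ z ∷ []) →
                 Related (a ∷ b ∷ c ∷ []) (x ∷ y ∷ z ∷ [])
  deck⇒Related a b c x y z p
    -- Locating the three cards in turn gives six alignments. Each is a reordering of `x`, `y`, `z`,
    -- absorbed by `Related-resp`; `Matched-comm` corrects the sums whose summands come out in the
    -- opposite order.
    with Deckₛ.∷-↭⇒select (↭C.trans (↭C.↭-sym (deck-triple a b c)) (↭C.trans p (deck-triple x y z)))
  deck⇒Related a b c x y z p | here (R , q) with Deckₛ.∷-↭⇒select q
  ... | here (Q , P) =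
    matched⇒Related (pair-↭⁻ R) (pair-↭⁻ Q) (pair-↭⁻ (Deckₛ.[-]-injective P))
  ... | there (here (Q , P)) = Related-resp ↭-refl (↭-swap x y ↭-refl)
    (matched⇒Related (Matched-comm (pair-↭⁻ R)) (pair-↭⁻ Q) (pair-↭⁻ (Deckₛ.[-]-injective P)))
  deck⇒Related a b c x y z p | there (here (R , q)) with Deckₛ.∷-↭⇒select q
  ... | here (Q , P) = Related-resp ↭-refl (↭-prep x (↭-swap y z ↭-refl))
    (matched⇒Related (pair-↭⁻ R) (pair-↭⁻ Q) (Matched-comm (pair-↭⁻ (Deckₛ.[-]-injective P))))
  ... | there (here (Q , P)) = Related-resp ↭-refl rotate
    (matched⇒Related (Matched-comm (pair-↭⁻ R)) (Matched-comm (pair-↭⁻ Q)) (pair-↭⁻ (Deckₛ.[-]-injective P)))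
  deck⇒Related a b c x y z p | there (there (here (R , q))) with Deckₛ.∷-↭⇒select q
  ... | here (Q , P) = Related-resp ↭-refl (Permutationₚ.++-comm setoid (x ∷ []) (y ∷ z ∷ []))
    (matched⇒Related (pair-↭⁻ R) (Matched-comm (pair-↭⁻ Q)) (Matched-comm (pair-↭⁻ (Deckₛ.[-]-injective P))))
  ... | there (here (Q , P)) = Related-resp ↭-refl (Permutationₚ.↭-reverse setoid (z ∷ y ∷ x ∷ []))
    (matched⇒Related (Matched-comm (pair-↭⁻ R)) (Matched-comm (pair-↭⁻ Q)) (Matched-comm (pair-↭⁻ (Deckₛ.[-]-injective P))))

mainTheorem5 : ∀ {c ℓ} (G : CommutativeMagma c ℓ) →
    let open Deck G in
    (M M′ : List Carrier) → length M ≡ 3 → length M′ ≡ 3 →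
    (deck M ≈ₘₘ deck M′) ⇔
    ( (M ≈ₘ M′)
    ⊎ (∃[ r ] ∃[ s ] ∃[ t ]
    ( (M ≈ₘ r ∷ s ∷ t ∷ [])
    × (M′ ≈ₘ r ∷ (r + s) ∷ (r + t) ∷ [])
    × ((r + (r + s)) ≈ s)
    × ((r + (r + t)) ≈ t)
    × (((r + s) + (r + t)) ≈ (s + t)) ))
    ⊎ (∃[ r ] ∃[ s ] ∃[ t ]
    ( (M ≈ₘ r ∷ s ∷ t ∷ [])
    × (M′ ≈ₘ (r + s) ∷ (r + t) ∷ (s + t) ∷ [])
    × (((r + s) + (r + t)) ≈ r)
    × (((r + s) + (s + t)) ≈ s)
    × (((r + t) + (s + t)) ≈ t) )) )
mainTheorem5 G (a ∷ b ∷ c ∷ []) (x ∷ y ∷ z ∷ []) ≡.refl ≡.refl =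
  mk⇔ (deck⇒Related a b c x y z) Related⇒deck
  where open ThreeDecks G
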